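{- There is a function $\pi:2^{\omega}\longrightarrow\omega^{\omega}$ such that for every $r\in2^{\omega}$, if $f$ is an infinite partial function with $f\subseteq\pi(r)$ (as sets of ordered pairs), then $r$ is definable from $f$.
   Context: $2^{\omega}$ is the set of infinite binary sequences and $\omega^{\omega}$ the set of functions from $\omega$ to $\omega$. A partial function $f$ from $\omega$ to $\omega$ is infinite if its domain is infinite. -}

module Defs where

open import Data.Nat using (ℕ; _≤_)
open import Data.Bool using (Bool; true)
open import Data.Product using (Σ; ∃; _×_)
open import Relation.Binary.PropositionalEquality using (_≡_)

Cantor : Set
Cantor = ℕ → Bool

Baire : Set
Baire = ℕ → ℕ

-- A subset of ω × ω (a set of ordered pairs), given by its characteristic
-- function (so that it can serve as an oracle).
PairSet : Set
PairSet = ℕ → ℕ → Bool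

IsPartialFunction : PairSet → Set
IsPartialFunction f = ∀ n k k′ → f n k ≡ true → f n k′ ≡ true → k ≡ k′

HasInfiniteDomain : PairSet → Set
HasInfiniteDomain f = ∀ m → ∃ λ n → m ≤ n × ∃ λ k → f n k ≡ true

_⊆graph_ : PairSet → Baire → Set
f ⊆graph g = ∀ n k → f n k ≡ true → g n ≡ k

module Submission where

-- Idea: π(r)(n) is the number whose binary expansion is the prefix
-- r 0 r 1 … r n, with r n as the least significant bit.  Bit m of r then
-- sits at depth n ∸ m in π(r)(n) for every n ≥ m, so a single value of π(r)
-- at any argument n ≥ m already determines r m.  An infinite partial
-- function f ⊆ π(r) has, for each m, a pair (n , k) ∈ f with n ≥ m and
-- k = π(r)(n); reading bit n ∸ m of k recovers r m.

open import Defs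
open import Data.Nat using (ℕ; zero; suc; _+_; _∸_; _≤_; ⌊_/2⌋)
open import Data.Nat.Properties using (+-suc; n≡⌊n+n/2⌋; n≡⌈n+n/2⌉; m∸n+n≡m)
open import Function using (_∘_)
open import Data.Bool using (Bool; true; false)
open import Data.Product using (Σ; ∃; _×_; _,_)
open import Relation.Binary.PropositionalEquality
  using (_≡_; refl; sym; cong; module ≡-Reasoning)

push : Bool → ℕ → ℕ
push false x = x + x
push true  x = suc (x + x)

lowBit : ℕ → Bool
lowBit zero          = false
lowBit (suc zero)    = true
lowBit (suc (suc x)) = lowBit x

⌊push/2⌋ : ∀ b x → ⌊ push b x /2⌋ ≡ x
⌊push/2⌋ false x = sym (n≡⌊n+n/2⌋ x)
⌊push/2⌋ true  x = sym (n≡⌈n+n/2⌉ x)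

push-suc : ∀ b x → push b (suc x) ≡ suc (suc (push b x))
push-suc false x = cong suc (+-suc x x)
push-suc true  x = cong (suc ∘ suc) (+-suc x x)

lowBit-push : ∀ b x → lowBit (push b x) ≡ b
lowBit-push false zero    = refl
lowBit-push true  zero    = refl
lowBit-push b     (suc x) = begin
  lowBit (push b (suc x))         ≡⟨ cong lowBit (push-suc b x) ⟩
  lowBit (suc (suc (push b x)))   ≡⟨ lowBit-push b x ⟩
  b                               ∎
  where open ≡-Reasoning

bit : ℕ → ℕ → Bool
bit zero    x = lowBit x
bit (suc d) x = bit d ⌊ x /2⌋

bit-push : ∀ d b x → bit (suc d) (push b x) ≡ bit d x
bit-push d b x = cong (bit d) (⌊push/2⌋ b x)

prefixCode : Cantor → ℕ → ℕ
prefixCode r zero    = push (r zero) zero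
prefixCode r (suc n) = push (r (suc n)) (prefixCode r n)

lowBit-prefixCode : ∀ r m → lowBit (prefixCode r m) ≡ r m
lowBit-prefixCode r zero    = lowBit-push (r zero) zero
lowBit-prefixCode r (suc m) = lowBit-push (r (suc m)) (prefixCode r m)

bit-prefixCode : ∀ r m d → bit d (prefixCode r (d + m)) ≡ r m
bit-prefixCode r m zero    = lowBit-prefixCode r m
bit-prefixCode r m (suc d) = begin
  bit (suc d) (push (r (suc (d + m))) (prefixCode r (d + m)))
    ≡⟨ bit-push d (r (suc (d + m))) (prefixCode r (d + m)) ⟩
  bit d (prefixCode r (d + m))
    ≡⟨ bit-prefixCode r m d ⟩
  r m ∎
  where open ≡-Reasoning

prefixCode-determines : ∀ r {m n} → m ≤ n → bit (n ∸ m) (prefixCode r n) ≡ r m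
prefixCode-determines r {m} {n} m≤n = begin
  bit (n ∸ m) (prefixCode r n)
    ≡⟨ cong (bit (n ∸ m) ∘ prefixCode r) (sym (m∸n+n≡m m≤n)) ⟩
  bit (n ∸ m) (prefixCode r ((n ∸ m) + m))
    ≡⟨ bit-prefixCode r m (n ∸ m) ⟩
  r m ∎
  where open ≡-Reasoning

readBit : ∀ {f : PairSet} m → (∃ λ n → m ≤ n × ∃ λ k → f n k ≡ true) → Bool
readBit m (n , _ , k , _) = bit (n ∸ m) k

mainTheorem1 : Σ (Cantor → Baire) λ π →
    Σ ((f : PairSet) → IsPartialFunction f → HasInfiniteDomain f → Cantor) λ decode →
    ∀ (r : Cantor) (f : PairSet) (pf : IsPartialFunction f) (inf : HasInfiniteDomain f) →
    f ⊆graph π r → ∀ n → decode f pf inf n ≡ r n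
mainTheorem1 = prefixCode , decode , decode-correct
  where
  decode : (f : PairSet) → IsPartialFunction f → HasInfiniteDomain f → Cantor
  decode f _ inf m = readBit {f} m (inf m)

  decode-correct : ∀ (r : Cantor) (f : PairSet) (pf : IsPartialFunction f)
    (inf : HasInfiniteDomain f) → f ⊆graph prefixCode r → ∀ m → decode f pf inf m ≡ r m
  decode-correct r f _ inf f⊆πr m with inf m
  ... | n , m≤n , k , fnk with f⊆πr n k fnk
  ... | refl = prefixCode-determines r m≤n
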